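{- Every countably infinite MB-homogeneous graph is HE-homogeneous.
   Context: All graphs are undirected and loopless; subgraphs are induced. A homomorphism maps adjacent vertices to adjacent vertices; a monomorphism is an injective homomorphism; a bimorphism of $G$ is a bijective endomorphism $G\to G$. $G$ is MB-homogeneous if every monomorphism between finite induced subgraphs of $G$ is the restriction of a bimorphism of $G$; $G$ is HE-homogeneous if every homomorphism between finite induced subgraphs of $G$ is the restriction of a surjective endomorphism of $G$. -}

module Defs where

open import Data.Fin.Base using (Fin)
open import Data.Nat.Base using (ℕ)
open import Data.Product.Base using (_×_; ∃-syntax)
open import Function.Base using (_on_; _∘_)
open import Function.Bundles using (_↣_; _⤖_; module Injection)
open import Function.Definitions using (Injective; Surjective; Bijective)
open import Level using (Level; _⊔_; suc)
open import Relation.Binary.Core using (Rel)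
open import Relation.Binary.Definitions using (Symmetric; Irreflexive)
open import Relation.Binary.Morphism.Definitions using (Homomorphic₂)
open import Relation.Binary.PropositionalEquality using (_≡_; cong)

open Injection using (to; injective)

private
  variable
    v e v′ e′ : Level

record Graph (v e : Level) : Set (suc (v ⊔ e)) where
  field
    Vertex     : Set v
    _~_        : Rel Vertex e
    undirected : Symmetric _~_
    loopless   : Irreflexive _≡_ _~_

open Graph using (Vertex)

CountablyInfinite : Graph v e → Set v
CountablyInfinite G = Vertex G ⤖ ℕ

-- The induced subgraph on the image of ι, with its vertices named by the
-- elements of W.
induced : (G : Graph v e) {W : Set v′} → W ↣ Vertex G → Graph v′ e
induced G {W} ι = record
  { Vertex     = W
  ; _~_        = G._~_ on to ι
  ; undirected = G.undirected
  ; loopless   = G.loopless ∘ cong (to ι)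
  }
  where module G = Graph G

module _ (G : Graph v e) (H : Graph v′ e′) (f : Vertex G → Vertex H) where

  IsHomomorphism : Set (v ⊔ e ⊔ e′)
  IsHomomorphism =
    Homomorphic₂ (Vertex G) (Vertex H) (Graph._~_ G) (Graph._~_ H) f

  IsMonomorphism : Set (v ⊔ e ⊔ v′ ⊔ e′)
  IsMonomorphism = IsHomomorphism × Injective _≡_ _≡_ f

module _ (G : Graph v e) (f : Vertex G → Vertex G) where

  IsBimorphism : Set (v ⊔ e)
  IsBimorphism = IsHomomorphism G G f × Bijective _≡_ _≡_ f

  IsSurjectiveEndomorphism : Set (v ⊔ e)
  IsSurjectiveEndomorphism = IsHomomorphism G G f × Surjective _≡_ _≡_ f

-- A finite induced subgraph is presented by a repetition-free enumeration
-- Fin n ↣ Vertex G of its vertices.  A map h between the subgraphs enumerated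
-- by A and B therefore sends the vertex A i to the vertex B (h i), and it is
-- the restriction of g exactly when g (A i) ≡ B (h i) for every i.

MB-Homogeneous : Graph v e → Set (v ⊔ e)
MB-Homogeneous G =
  ∀ {m n} (A : Fin m ↣ Vertex G) (B : Fin n ↣ Vertex G) (h : Fin m → Fin n) →
  IsMonomorphism (induced G A) (induced G B) h →
  ∃[ g ] IsBimorphism G g × (∀ i → g (to A i) ≡ to B (h i))

HE-Homogeneous : Graph v e → Set (v ⊔ e)
HE-Homogeneous G =
  ∀ {m n} (A : Fin m ↣ Vertex G) (B : Fin n ↣ Vertex G) (h : Fin m → Fin n) →
  IsHomomorphism (induced G A) (induced G B) h →
  ∃[ g ] IsSurjectiveEndomorphism G g × (∀ i → g (to A i) ≡ to B (h i))

{-# OPTIONS --safe #-}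
module Submission where

-- A surjective extension is built by back and forth.  The forth step always
-- works, because homomorphic images of finite sets with a common neighbour
-- have one (transfer).  The back step is immediate if every finite set has a
-- common neighbour in the complement H, which is MB-homogeneous as well.
-- Otherwise G has a vertex of infinite degree, hence every finite clique of G
-- has a common neighbour, and H contains independent sets of every size.
-- Let k be least such that some set of k + 1 vertices has no common neighbour
-- in H.  A configuration of triangles and independent sets rules out k ≥ 2.
-- So independent pairs have no common neighbour: H is a disjoint union of
-- cliques, which are infinite unless H has no edges, and the back step can be
-- made inside one clique.

open import Defs
open import Axiom.ExcludedMiddle using (ExcludedMiddle)
open import Data.Empty using (⊥-elim)
open import Data.Fin.Base using (Fin; zero; suc)
open import Data.List.Base
  using (List; []; _∷_; _++_; map; zip; length; lookup; filter; deduplicate; allFin)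
open import Data.List.Membership.Propositional using (_∈_; _∉_; find)
open import Data.List.Membership.Propositional.Properties
  using (∈-map⁺; ∈-map⁻; ∈-allFin; ∈-filter⁺; ∈-filter⁻; ∈-deduplicate⁻; ∈-lookup)
open import Data.List.Relation.Unary.All as All using (All; []; _∷_)
open import Data.List.Relation.Unary.All.Properties as Allₚ using (¬Any⇒All¬; ¬All⇒Any¬)
open import Data.List.Relation.Unary.AllPairs as AllPairs using (AllPairs; []; _∷_)
import Data.List.Relation.Unary.AllPairs.Properties as AllPairsₚ
open import Data.List.Relation.Unary.Any as Any using (Any; here; there; any?)
import Data.List.Relation.Unary.Any.Properties as Anyₚ
open import Data.Nat.Base as ℕ using (ℕ; zero; suc; _+_; _<_; _≤′_; ≤′-refl; ≤′-step)
open import Data.Nat.Properties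
  using (suc-injective; ≤⇒≤′; m≤m⊔n; m≤n⊔m; <-≤-trans; <-irrefl; n<1+n)
open import Data.Product.Base using (_×_; _,_; proj₁; proj₂; ∃-syntax; Σ-syntax)
open import Data.Sum.Base using (_⊎_; inj₁; inj₂)
open import Function.Base using (_∘_; _on_; case_of_; const)
open import Function.Bundles using (_↣_; mk↣; module Injection; module Bijection)
open import Level using (Level; Lift; lift; lower; _⊔_)
open import Relation.Binary.Definitions using (Decidable; DecidableEquality)
open import Relation.Binary.PropositionalEquality
  using (_≡_; _≢_; refl; sym; trans; cong; subst; ≢-sym)
open import Relation.Nullary.Decidable using (yes; no; map′; ¬?; decidable-stable)
open import Relation.Nullary.Negation using (¬_; contradiction)

private
  variable
    a b v e : Level
    A : Set a
    B : Set b

-- Lists: distinctness and zipping.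

lookup-injective-on : (f : A → B) {xs : List A} → AllPairs (λ x y → f x ≢ f y) xs →
  ∀ {i j} → f (lookup xs i) ≡ f (lookup xs j) → i ≡ j
lookup-injective-on f (_ ∷ _)   {zero}  {zero}  _  = refl
lookup-injective-on f (h ∷ _)   {zero}  {suc j} eq =
  contradiction eq (All.lookup h (∈-lookup j))
lookup-injective-on f (h ∷ _)   {suc i} {zero}  eq =
  contradiction (sym eq) (All.lookup h (∈-lookup i))
lookup-injective-on f (_ ∷ xs!) {suc i} {suc j} eq =
  cong suc (lookup-injective-on f xs! eq)

module _ {p} {P : A → Set p} where

  zip-proj₁ : ∀ {xs} → All P xs → (ys : List B) → All (P ∘ proj₁) (zip xs ys)
  zip-proj₁ []         _        = []
  zip-proj₁ (_ ∷ _)    []       = []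
  zip-proj₁ (px ∷ pxs) (_ ∷ ys) = px ∷ zip-proj₁ pxs ys

  zip-proj₂⁻ : (xs : List B) {ys : List A} → length xs ≡ length ys →
    All (P ∘ proj₂) (zip xs ys) → All P ys
  zip-proj₂⁻ []       {[]}     _  _          = []
  zip-proj₂⁻ (_ ∷ xs) {_ ∷ ys} eq (py ∷ pys) = py ∷ zip-proj₂⁻ xs (suc-injective eq) pys

zip-AllPairs : ∀ {r} {R : A → A → Set r} {xs} → AllPairs R xs →
  (ys : List B) → AllPairs (R on proj₁) (zip xs ys)
zip-AllPairs []         _        = []
zip-AllPairs (_ ∷ _)    []       = []
zip-AllPairs (rx ∷ rxs) (_ ∷ ys) = zip-proj₁ rx ys ∷ zip-AllPairs rxs ys

-- Finite partial homomorphisms.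

module Basics (G : Graph v e) where

  open Graph G

  Coned : List Vertex → Set _
  Coned xs = ∃[ c ] All (c ~_) xs

  infix 4 _⊥_

  _⊥_ : Vertex → Vertex → Set _
  x ⊥ y = x ≢ y × ¬ x ~ y

  ⊥-sym : ∀ {x y} → x ⊥ y → y ⊥ x
  ⊥-sym (x≢y , x≁y) = ≢-sym x≢y , x≁y ∘ undirected

  Independent : List Vertex → Set _
  Independent = AllPairs _⊥_

  irreflexive : ∀ {x} → ¬ x ~ x
  irreflexive = loopless refl

  ~⇒≢ : ∀ {x y} → x ~ y → x ≢ y
  ~⇒≢ x~y refl = irreflexive x~y

  -- A finite map is kept as a list of pairs, so single-valuedness has to be demanded; repeated
  -- entries stay harmless.
  Compatible : Vertex × Vertex → Vertex × Vertex → Set _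
  Compatible (x , y) (x′ , y′) = (x ≡ x′ → y ≡ y′) × (x ~ x′ → y ~ y′)

  Compatible-refl : ∀ {p} → Compatible p p
  Compatible-refl = const refl , ⊥-elim ∘ irreflexive

  Compatible-sym : ∀ {p q} → Compatible p q → Compatible q p
  Compatible-sym (f , h) = sym ∘ f ∘ sym , undirected ∘ h ∘ undirected

  ~⇒Compatible : ∀ {x x′ y y′} → x ~ x′ → y ~ y′ → Compatible (x , y) (x′ , y′)
  ~⇒Compatible x~x′ y~y′ = (λ eq → contradiction eq (~⇒≢ x~x′)) , const y~y′

  ⊥⇒Compatible : ∀ {x x′ y y′} → x ⊥ x′ → Compatible (x , y) (x′ , y′)
  ⊥⇒Compatible (x≢x′ , x≁x′) = (λ eq → contradiction eq x≢x′) , (λ x~x′ → contradiction x~x′ x≁x′)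

  PartialHom : List (Vertex × Vertex) → Set _
  PartialHom ps = ∀ {p q} → p ∈ ps → q ∈ ps → Compatible p q

  fromAllPairs : ∀ {ps} → AllPairs Compatible ps → PartialHom ps
  fromAllPairs (_ ∷ _)  (here refl) (here refl) = Compatible-refl
  fromAllPairs (h ∷ _)  (here refl) (there q∈)  = All.lookup h q∈
  fromAllPairs (h ∷ _)  (there p∈)  (here refl) = Compatible-sym (All.lookup h p∈)
  fromAllPairs (_ ∷ hs) (there p∈)  (there q∈)  = fromAllPairs hs p∈ q∈

  extend : ∀ {p ps} → PartialHom ps → All (Compatible p) ps → PartialHom (p ∷ ps)
  extend hom h (here refl) (here refl) = Compatible-refl
  extend hom h (here refl) (there q∈)  = All.lookup h q∈
  extend hom h (there p∈)  (here refl) = Compatible-sym (All.lookup h p∈)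
  extend hom h (there p∈)  (there q∈)  = hom p∈ q∈

-- Moving common neighbours along partial homomorphisms.

module Homogeneous (em : ExcludedMiddle (v ⊔ e)) (G : Graph v e)
                   (mb : MB-Homogeneous G) where

  open Graph G
  open Basics G public

  _~?_ : Decidable _~_
  x ~? y = map′ lower lift (em {Lift v (x ~ y)})

  _≟_ : DecidableEquality Vertex
  x ≟ y = map′ lower lift (em {Lift e (x ≡ y)})

  -- By the equality clause of `Compatible`, distinct second coordinates force distinct first ones,
  -- so positions in `ps` index both subgraphs and the identity on them is the monomorphism.
  extendToBimorphism : ∀ {ps} → PartialHom ps → AllPairs (λ p q → proj₂ p ≢ proj₂ q) ps →
    ∃[ g ] IsBimorphism G g × (∀ {p} → p ∈ ps → g (proj₁ p) ≡ proj₂ p)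
  extendToBimorphism {ps} hom ps! = case mb A′ B′ (λ i → i) (edge , λ eq → eq) of λ where
      (g , bi , restr) → g , bi , λ {p} p∈ps →
        subst (λ q → g (proj₁ q) ≡ proj₂ q) (sym (Anyₚ.lookup-index p∈ps)) (restr (Any.index p∈ps))
    where
    compatible : ∀ i j → Compatible (lookup ps i) (lookup ps j)
    compatible i j = hom (∈-lookup i) (∈-lookup j)
    B′ : Fin (length ps) ↣ Vertex
    B′ = mk↣ {to = proj₂ ∘ lookup ps} (lookup-injective-on proj₂ ps!)
    A′ : Fin (length ps) ↣ Vertex
    A′ = mk↣ {to = proj₁ ∘ lookup ps}
      (λ {i} {j} eq → lookup-injective-on proj₂ ps! (proj₁ (compatible i j) eq))
    edge : IsHomomorphism (induced G A′) (induced G B′) (λ i → i)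
    edge {i} {j} = proj₂ (compatible i j)

  -- A homomorphic image of a coned set is coned: restrict the homomorphism
  -- to a transversal, where it is injective.
  transfer : ∀ {ps c} → PartialHom ps → All ((c ~_) ∘ proj₁) ps →
    ∃[ d ] All ((d ~_) ∘ proj₂) ps
  transfer {ps} {c} hom cone = case extendToBimorphism hom′ qs! of λ where
      (g , (g-hom , _) , restr) → g c , All.tabulate λ {p} p∈ps →
        case find (covered p∈ps) of λ where
          (q , q∈qs , eq) → subst (g c ~_) (trans (restr q∈qs) eq)
            (g-hom (All.lookup cone (∈-deduplicate⁻ R? ps q∈qs)))
    where
    R? : Decidable (λ (p q : Vertex × Vertex) → proj₂ p ≡ proj₂ q)
    R? p q = proj₂ p ≟ proj₂ q
    qs : List (Vertex × Vertex)
    qs = deduplicate R? ps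
    qs! : AllPairs (λ p q → proj₂ p ≢ proj₂ q) qs
    qs! = dedup! ps
      where
      dedup! : ∀ xs → AllPairs (λ p q → proj₂ p ≢ proj₂ q) (deduplicate R? xs)
      dedup! []       = []
      dedup! (x ∷ xs) = Allₚ.all-filter (¬? ∘ R? x) (deduplicate R? xs)
                      ∷ AllPairsₚ.filter⁺ (¬? ∘ R? x) (dedup! xs)
    hom′ : PartialHom qs
    hom′ p∈ q∈ = hom (∈-deduplicate⁻ R? ps p∈) (∈-deduplicate⁻ R? ps q∈)
    covered : ∀ {p} → p ∈ ps → Any (λ q → proj₂ q ≡ proj₂ p) qs
    covered p∈ = Anyₚ.deduplicate⁺ R? (λ eq eq′ → trans eq eq′)
      (Any.map (λ { refl → refl }) p∈)

  -- Only the domain vertices adjacent to `x` constrain a new image; `x` cones them, so `transfer`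
  -- cones their images.
  forth : ∀ {ps} → PartialHom ps → ∀ x → ∃[ y ] PartialHom ((x , y) ∷ ps)
  forth {ps} hom x with any? (λ p → x ≟ proj₁ p) ps
  ... | yes x∈ with find x∈
  ...   | (_ , y) , p∈ , refl = y , extend hom (All.tabulate (hom p∈))
  forth {ps} hom x | no x∉ = y , extend hom (All.tabulate λ {p} p∈ →
          (λ eq → ⊥-elim (x∉ (Any.map (λ { refl → eq }) p∈))) ,
          (λ x~p → All.lookup (proj₂ image) (∈-filter⁺ adj? p∈ x~p)))
    where
    adj? = λ (p : Vertex × Vertex) → x ~? proj₁ p
    image = transfer {filter adj? ps} {x}
      (λ p∈ q∈ → hom (proj₁ (∈-filter⁻ adj? p∈)) (proj₁ (∈-filter⁻ adj? q∈)))
      (Allₚ.all-filter adj? ps)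
    y = proj₁ image

  Unbounded : (Vertex → Set (v ⊔ e)) → Set _
  Unbounded P = ∀ L → ∃[ x ] x ∉ L × P x

  -- Distinct neighbours of `u` can be matched with `K` whatever edges they span, since `K` has all
  -- edges.
  clique⇒coned : ∀ {u} → Unbounded (λ x → Lift v (u ~ x)) →
    ∀ {K} → AllPairs _~_ K → Coned K
  clique⇒coned {u} unb clique = case build clique of λ where
      (ps , refl , ps! , cone) → case transfer (fromAllPairs ps!) cone of λ where
        (d , h) → d , Allₚ.map⁺ h
    where
    build : ∀ {K} → AllPairs _~_ K → ∃[ ps ] map proj₂ ps ≡ K × AllPairs Compatible ps ×
      All ((u ~_) ∘ proj₁) ps
    build [] = [] , refl , [] , []
    build {y ∷ _} (y~ ∷ K!) with build K!
    ... | ps , refl , ps! , cone with unb (map proj₁ ps)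
    ...   | x , x∉ , lift u~x =
      (x , y) ∷ ps , refl ,
      All.tabulate (λ p∈ → (λ { refl → ⊥-elim (x∉ (∈-map⁺ proj₁ p∈)) }) ,
                           const (All.lookup (Allₚ.map⁻ y~) p∈)) ∷ ps! ,
      u~x ∷ cone

  -- The vertices of `W` have no edges among themselves or to the domain of `ps`, so they may be
  -- sent to arbitrary `zs`, even with repetitions.
  transfer-⊥ : ∀ ps {W zs d} → AllPairs Compatible ps → Independent W →
    All (λ p → All (proj₁ p ⊥_) W) ps → length W ≡ length zs →
    All (d ~_) (map proj₁ ps ++ W) → Coned (map proj₂ ps ++ zs)
  transfer-⊥ ps {W} {zs} ps! W! ps⊥W len cone =
    case transfer (fromAllPairs (AllPairsₚ.++⁺ ps! zip! cross)) cone′ of λ where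
      (c , h) → c , Allₚ.++⁺ (Allₚ.map⁺ (Allₚ.++⁻ˡ ps h))
                             (zip-proj₂⁻ W len (Allₚ.++⁻ʳ ps h))
    where
    zip! : AllPairs Compatible (zip W zs)
    zip! = AllPairs.map ⊥⇒Compatible (zip-AllPairs W! zs)
    cross : All (λ p → All (Compatible p) (zip W zs)) ps
    cross = All.map (λ p⊥W → All.map ⊥⇒Compatible (zip-proj₁ p⊥W zs)) ps⊥W
    cone′ : All ((_ ~_) ∘ proj₁) (ps ++ zip W zs)
    cone′ = Allₚ.++⁺ (Allₚ.map⁻ (Allₚ.++⁻ˡ (map proj₁ ps) cone))
                     (zip-proj₁ (Allₚ.++⁻ʳ (map proj₁ ps) cone) zs)

  -- Coning thresholds of two or more.

  -- Suppose every list of length 2 + m is coned but no independent list of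
  -- length 3 + m is.  If c cones an independent F of length 2 + m, then c is
  -- non-adjacent to everything independent of F, while each neighbour of c
  -- outside F has a neighbour in F.
  module _ (m : ℕ)
    (coned : ∀ L → length L ≡ 2 + m → Coned L)
    (unconed : ∀ {I} → Independent I → length I ≡ 3 + m → ¬ Coned I)
    (fresh : ∀ k {J} → Independent J → ∃[ W ] length W ≡ k × Independent W ×
       All (λ j → All (j ⊥_) W) J)
    where

    private
      swap : ∀ {I J} → All (λ i → All (i ⊥_) J) I → All (λ j → All (j ⊥_) I) J
      swap = All.map (All.map ⊥-sym) ∘ Allₚ.All-swap

      -- `w` certifies that `x` lies outside `F`. Without a neighbour in `F`, `x` would extend `F`
      -- to an independent set of size `3 + m` coned by `c`.
      hit : ∀ {F c x w} → Independent F → length F ≡ 2 + m → All (c ~_) F →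
        c ~ x → x ~ w → All (w ⊥_) F → ∃[ f ] f ∈ F × x ~ f
      hit {F} {c} {x} F! len c~F c~x x~w w⊥F with any? (x ~?_) F
      ... | yes x~F = find x~F
      ... | no  x≁F = contradiction (c , c~x ∷ c~F)
        (unconed (All.tabulate (λ f∈ →
          (λ { refl → proj₂ (All.lookup w⊥F f∈) (undirected x~w) }) ,
          All.lookup (¬Any⇒All¬ F x≁F) f∈) ∷ F!) (cong suc len))

      miss : ∀ {F c w} → Independent F → length F ≡ 2 + m → All (c ~_) F →
        All (w ⊥_) F → c ⊥ w
      miss {_ ∷ _} F! len c~F@(c~f ∷ _) w⊥F@(w⊥f ∷ _) =
        (λ { refl → proj₂ w⊥f c~f }) ,
        (λ c~w → unconed (w⊥F ∷ F!) (cong suc len) (_ , c~w ∷ c~F))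

    -- One model suffices: `d` cones `c` and `w ∷ W` and hits `F` in a neighbour `a` of `c`, so it
    -- cones the edge `c a` together with an independent set having no edges to it.
    edge-coned : ∀ {x y zs} → x ~ y → length zs ≡ 1 + m → Coned (x ∷ y ∷ zs)
    edge-coned {x} {y} {zs} x~y len
      with F , F-len , F! , _ ← fresh (2 + m) []
      with fresh (1 + m) F!
    ... | w ∷ W , W-len , W! , F⊥W
      with c , c~F ← coned F F-len
      with d , d~c ∷ d~w ∷ d~W ← coned (c ∷ w ∷ W) (cong suc W-len)
      with W⊥F ← swap F⊥W
      with a , a∈F , d~a ← hit F! F-len c~F (undirected d~c) d~w (All.head W⊥F) =
      transfer-⊥ ((c , x) ∷ (a , y) ∷ [])
        ((~⇒Compatible (All.lookup c~F a∈F) x~y ∷ []) ∷ [] ∷ []) W!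
        (All.map (miss F! F-len c~F) W⊥F ∷ All.lookup F⊥W a∈F ∷ [])
        (trans W-len (sym len)) (d~c ∷ d~a ∷ d~w ∷ d~W)

    -- The model edges `c a` and `c′ a′` come from mutually independent `F` and `F′`; no edges join
    -- them once `c ~ c′` is excluded.
    two-edges-coned : ∀ {x₁ y₁ x₂ y₂ zs} → x₁ ~ y₁ → x₂ ~ y₂ → length zs ≡ m →
      Coned (x₁ ∷ y₁ ∷ x₂ ∷ y₂ ∷ zs)
    two-edges-coned {x₁} {y₁} {x₂} {y₂} x₁~y₁ x₂~y₂ len
      with F , F-len , F! , _ ← fresh (2 + m) []
      with F′ , F′-len , F′! , F⊥F′ ← fresh (2 + m) F!
      with fresh (1 + m) (AllPairsₚ.++⁺ F! F′! F⊥F′)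
    ... | w ∷ W , W-len , W!@(_ ∷ W′!) , FF′⊥W
      with F⊥W ← Allₚ.++⁻ˡ F FF′⊥W | F′⊥W ← Allₚ.++⁻ʳ F FF′⊥W
      with W⊥F ← swap F⊥W | W⊥F′ ← swap F′⊥W | F′⊥F ← swap F⊥F′
      with c , c~F ← coned F F-len | c′ , c′~F′ ← coned F′ F′-len
      with c⊥F′ ← All.map (miss F! F-len c~F) F′⊥F
         | c′⊥F ← All.map (miss F′! F′-len c′~F′) F⊥F′
      with c ~? c′
    ...   | yes c~c′ = ⊥-elim absurd
      where
      -- A cone `e` of the edge `c c′` and `w ∷ W` would hit both `F` and `F′`, hence cone an
      -- independent set of size `3 + m`.
      absurd : _
      absurd
        with e , e~c ∷ e~c′ ∷ e~w ∷ e~W ← edge-coned c~c′ W-len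
        with f , f∈ , e~f ← hit F! F-len c~F (undirected e~c) e~w (All.head W⊥F)
        with f′ , f′∈ , e~f′ ← hit F′! F′-len c′~F′ (undirected e~c′) e~w (All.head W⊥F′) =
        unconed ((All.lookup (All.lookup F⊥F′ f∈) f′∈ ∷ All.lookup F⊥W f∈) ∷
                 All.lookup F′⊥W f′∈ ∷ W!)
          (cong (2 +_) W-len) (e , e~f ∷ e~f′ ∷ e~w ∷ e~W)
    ...   | no c≁c′
      with d , d~c ∷ d~c′ ∷ d~W ← coned (c ∷ c′ ∷ W) (cong suc W-len)
      with a , a∈ , d~a ← hit F! F-len c~F (undirected d~c) d~c′ c′⊥F
      with a′ , a′∈ , d~a′ ← hit F′! F′-len c′~F′ (undirected d~c′) d~c c⊥F′ =
      transfer-⊥ ((c , x₁) ∷ (a , y₁) ∷ (c′ , x₂) ∷ (a′ , y₂) ∷ [])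
        ((~⇒Compatible (All.lookup c~F a∈) x₁~y₁ ∷ ⊥⇒Compatible c⊥c′
            ∷ ⊥⇒Compatible (All.lookup c⊥F′ a′∈) ∷ []) ∷
         (⊥⇒Compatible (⊥-sym (All.lookup c′⊥F a∈))
            ∷ ⊥⇒Compatible (All.lookup (All.lookup F⊥F′ a∈) a′∈) ∷ []) ∷
         (~⇒Compatible (All.lookup c′~F′ a′∈) x₂~y₂ ∷ []) ∷ [] ∷ []) W′!
        (All.map (miss F! F-len c~F) (All.tail W⊥F) ∷ All.tail (All.lookup F⊥W a∈) ∷
         All.map (miss F′! F′-len c′~F′) (All.tail W⊥F′) ∷ All.tail (All.lookup F′⊥W a′∈) ∷ [])
        (trans (suc-injective W-len) (sym len)) (d~c ∷ d~a ∷ d~c′ ∷ d~a′ ∷ d~W)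
      where
      c⊥c′ : c ⊥ c′
      c⊥c′ = (λ { refl → proj₂ (All.lookup c′⊥F a∈) (All.lookup c~F a∈) }) , c≁c′

    -- `k₁` and `k₂` are adjacent and both cone `F`, so a neighbour `a` of `d` in `F` completes a
    -- triangle coned by `d`.
    triangle-coned : ∀ {x y z zs} → x ~ y → x ~ z → y ~ z → length zs ≡ 1 + m →
      Coned (x ∷ y ∷ z ∷ zs)
    triangle-coned {x} {y} {z} x~y x~z y~z len
      with fresh (2 + m) []
    ... | f ∷ F′ , F-len , F! , _
      with fresh (1 + m) F!
    ...   | w ∷ W , W-len , W! , F⊥W
      with W⊥F ← swap F⊥W
      with k₁ , k₁~F@(k₁~f ∷ _) ← coned (f ∷ F′) F-len
      with k₂ , k₂~k₁ ∷ k₂~F ← edge-coned {zs = F′} k₁~f (suc-injective F-len)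
      with d , d~k₁ ∷ d~k₂ ∷ d~w ∷ d~W ← edge-coned (undirected k₂~k₁) W-len
      with a , a∈ , d~a ← hit F! F-len k₁~F (undirected d~k₁) d~w (All.head W⊥F) =
      transfer-⊥ ((k₁ , x) ∷ (k₂ , y) ∷ (a , z) ∷ [])
        ((~⇒Compatible (undirected k₂~k₁) x~y ∷ ~⇒Compatible (All.lookup k₁~F a∈) x~z ∷ []) ∷
         (~⇒Compatible (All.lookup k₂~F a∈) y~z ∷ []) ∷ [] ∷ []) W!
        (All.map (miss F! F-len k₁~F) W⊥F ∷ All.map (miss F! F-len k₂~F) W⊥F ∷
         All.lookup F⊥W a∈ ∷ [])
        (trans W-len (sym len)) (d~k₁ ∷ d~k₂ ∷ d~a ∷ d~w ∷ d~W)

    -- F₁ = xzA, F₂ = zyA and F₃ = xyB have no common element, and their cones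
    -- p₁, p₂, p₃ can be chosen to form a triangle.  A cone of p₁p₂p₃W hits each
    -- Fᵢ, hence two distinct elements of their union besides all of W.
    cone-threshold-absurd : Data.Empty.⊥
    cone-threshold-absurd
      with fresh (3 + m) []
    ... | x ∷ y ∷ z ∷ A , A-len , L!@(x⊥@(x⊥y ∷ x⊥z ∷ x⊥A) ∷ y⊥@(y⊥z ∷ y⊥A) ∷ z⊥A ∷ A!) , _
      with B , B-len , B! , L⊥B@(x⊥B ∷ y⊥B ∷ z⊥B ∷ A⊥B) ← fresh m L!
      with fresh (1 + m) (AllPairsₚ.++⁺ L! B! L⊥B)
    ...   | w ∷ W , W-len , W! , LB⊥W@(x⊥W ∷ y⊥W ∷ z⊥W ∷ AB⊥W)
      with A⊥W ← Allₚ.++⁻ˡ A AB⊥W | B⊥W ← Allₚ.++⁻ʳ A AB⊥W = absurd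
      where
      Am : length A ≡ m
      Am = suc-injective (suc-injective (suc-injective A-len))
      F₁! : Independent (x ∷ z ∷ A)
      F₁! = (x⊥z ∷ x⊥A) ∷ z⊥A ∷ A!
      F₂! : Independent (z ∷ y ∷ A)
      F₂! = (⊥-sym y⊥z ∷ z⊥A) ∷ y⊥A ∷ A!
      F₃! : Independent (x ∷ y ∷ B)
      F₃! = (x⊥y ∷ x⊥B) ∷ y⊥B ∷ B!
      F₁⊥W : All (λ f → All (f ⊥_) (w ∷ W)) (x ∷ z ∷ A)
      F₁⊥W = x⊥W ∷ z⊥W ∷ A⊥W
      F₂⊥W : All (λ f → All (f ⊥_) (w ∷ W)) (z ∷ y ∷ A)
      F₂⊥W = z⊥W ∷ y⊥W ∷ A⊥W
      F₃⊥W : All (λ f → All (f ⊥_) (w ∷ W)) (x ∷ y ∷ B)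
      F₃⊥W = x⊥W ∷ y⊥W ∷ B⊥W
      absurd : Data.Empty.⊥
      absurd
        with p₁ , p₁~F₁@(p₁~x ∷ p₁~z ∷ _) ← coned (x ∷ z ∷ A) (cong (2 +_) Am)
        with p₂ , p₂~p₁ ∷ p₂~F₂@(p₂~z ∷ p₂~y ∷ _) ←
               edge-coned {zs = y ∷ A} p₁~z (cong suc Am)
        with p₃ , p₃~p₁ ∷ p₃~x ∷ p₃~p₂ ∷ p₃~y ∷ p₃~B ← two-edges-coned {zs = B} p₁~x p₂~y B-len
        with e , e~p₁ ∷ e~p₂ ∷ e~p₃ ∷ e~w ∷ e~W ←
               triangle-coned (undirected p₂~p₁) (undirected p₃~p₁) (undirected p₃~p₂) W-len
        with f₁ , f₁∈ , e~f₁ ← hit F₁! (cong (2 +_) Am) p₁~F₁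
               (undirected e~p₁) e~w (All.head (swap F₁⊥W))
        with f₂ , f₂∈ , e~f₂ ← hit F₂! (cong (2 +_) Am) p₂~F₂
               (undirected e~p₂) e~w (All.head (swap F₂⊥W))
        with f₃ , f₃∈ , e~f₃ ← hit F₃! (cong (2 +_) B-len) (p₃~x ∷ p₃~y ∷ p₃~B)
               (undirected e~p₃) e~w (All.head (swap F₃⊥W)) = cases f₃∈
        where
        distinct : ∀ {f} → f₃ ⊥ f → All (f ⊥_) (w ∷ W) → e ~ f → Data.Empty.⊥
        distinct f₃⊥f f⊥W e~f =
          unconed ((f₃⊥f ∷ All.lookup F₃⊥W f₃∈) ∷ f⊥W ∷ W!) (cong (2 +_) W-len)
            (e , e~f₃ ∷ e~f ∷ e~w ∷ e~W)
        cases : f₃ ∈ x ∷ y ∷ B → Data.Empty.⊥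
        cases (here refl) = distinct (All.lookup (x⊥z ∷ x⊥y ∷ x⊥A) f₂∈)
          (All.lookup F₂⊥W f₂∈) e~f₂
        cases (there (here refl)) = distinct (All.lookup (⊥-sym x⊥y ∷ y⊥z ∷ y⊥A) f₁∈)
          (All.lookup F₁⊥W f₁∈) e~f₁
        cases (there (there f₃∈B)) = distinct
          (All.lookup (All.lookup (swap (x⊥B ∷ z⊥B ∷ A⊥B)) f₃∈B) f₁∈)
          (All.lookup F₁⊥W f₁∈) e~f₁

  -- From pairs to all finite sets.

  module _
    (fresh : ∀ k {J} → Independent J → ∃[ W ] length W ≡ k × Independent W ×
       All (λ j → All (j ⊥_) W) J)
    where

    -- If `L` were unconed, no independent list of its length could be coned, since such a list maps
    -- anywhere; this is the threshold just excluded.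
    coned-step : ∀ m → (∀ L → length L ≡ 2 + m → Coned L) → ∀ L → length L ≡ 3 + m → Coned L
    coned-step m coned L len = decidable-stable em λ L-unconed →
      cone-threshold-absurd m coned
        (λ I! I-len (c , c~I) → L-unconed (transfer-⊥ [] [] I! [] (trans I-len (sym len)) c~I))
        fresh

    coned-above : (∀ L → length L ≡ 2 → Coned L) → ∀ m L → length L ≡ 2 + m → Coned L
    coned-above pairs zero    = pairs
    coned-above pairs (suc m) = coned-step m (coned-above pairs m)

    coned-pairs⇒coned : (∀ L → length L ≡ 2 → Coned L) → ∀ L → Coned L
    coned-pairs⇒coned pairs []      with fresh 2 []
    ... | W , W-len , _ with c , _ ← pairs W W-len = c , []
    coned-pairs⇒coned pairs (x ∷ L)
      -- Repeating `x` brings the length to at least two.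
      with c , _ ∷ c~ ← coned-above pairs (length L) (x ∷ x ∷ L) refl = c , c~

  coned-⊥⇒coned-pairs : ∀ {x y c} → x ⊥ y → c ~ x → c ~ y → ∀ L → length L ≡ 2 → Coned L
  coned-⊥⇒coned-pairs x⊥y c~x c~y L len =
    transfer-⊥ [] [] ((x⊥y ∷ []) ∷ [] ∷ []) [] (sym len) (c~x ∷ c~y ∷ [])

  -- Disjoint unions of cliques.

  -- Without coned independent pairs the graph is a disjoint union of cliques.
  -- Sending w to a neighbour of u while fixing u shows that no finite part of
  -- the clique of u exhausts it.
  star-coned : (∀ {x y c} → x ⊥ y → c ~ x → ¬ c ~ y) →
    ∀ {s t u w L} → s ~ t → w ⊥ u → All (u ~_) L → Coned (u ∷ L)
  star-coned no-⊥-cone {s} {t} {u} {w} {L} s~t w⊥u u~L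
    -- The edge `s ~ t`, transferred along `s ↦ u`, provides a neighbour `k` of `u`.
    with k , k~u ∷ [] ← transfer {(s , u) ∷ []} (fromAllPairs ([] ∷ [])) (undirected s~t ∷ [])
    -- `g` fixes `u` and sends `w` to `k`; injectivity keeps `k` distinct from the images of
    -- neighbours of `u`, since `w` is not one.
    with g , (g-hom , g-inj , _) , restr ←
           extendToBimorphism (fromAllPairs ((⊥⇒Compatible (⊥-sym w⊥u) ∷ []) ∷ [] ∷ []))
             ((≢-sym (~⇒≢ k~u) ∷ []) ∷ [] ∷ []) =
    case transfer {map (λ x → g x , x) (u ∷ L)} hom (Allₚ.map⁺ cone) of λ where
      (d , d~) → d , Allₚ.map⁻ d~
    where
    common : ∀ {x y c} → c ~ x → c ~ y → x ≢ y → x ~ y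
    common {x} {y} c~x c~y x≢y = decidable-stable (x ~? y)
      (λ x≁y → no-⊥-cone (x≢y , x≁y) c~x c~y)
    clique : ∀ {x y} → x ∈ u ∷ L → y ∈ u ∷ L → x ≢ y → x ~ y
    clique (here refl) (here refl) x≢y = contradiction refl x≢y
    clique (here refl) (there y∈)  _   = All.lookup u~L y∈
    clique (there x∈)  (here refl) _   = undirected (All.lookup u~L x∈)
    clique (there x∈)  (there y∈)      = common (All.lookup u~L x∈) (All.lookup u~L y∈)
    -- The inverse of `g` need not preserve edges in general, but its values here are distinct
    -- vertices of a clique.
    hom : PartialHom (map (λ x → g x , x) (u ∷ L))
    hom p∈ q∈ with ∈-map⁻ (λ x → g x , x) p∈ | ∈-map⁻ (λ x → g x , x) q∈
    ... | x , x∈ , refl | y , y∈ , refl =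
      g-inj , λ gx~gy → clique x∈ y∈ (λ { refl → irreflexive gx~gy })
    gu≡u : g u ≡ u
    gu≡u = restr (here refl)
    gw≡k : g w ≡ k
    gw≡k = restr (there (here refl))
    k≢gx : ∀ {x} → u ~ x → k ≢ g x
    k≢gx u~x k≡gx = proj₂ w⊥u (undirected (subst (u ~_) (g-inj (trans (sym k≡gx) (sym gw≡k))) u~x))
    cone : All (λ x → k ~ g x) (u ∷ L)
    cone = subst (k ~_) (sym gu≡u) k~u ∷ All.map (λ {x} u~x →
      common (undirected k~u) (subst (_~ g x) gu≡u (g-hom u~x)) (k≢gx u~x)) u~L

  -- Such an `x` cannot occur in `L`, as it would be its own neighbour.
  dominate-neighbours : (∀ {x y c} → x ⊥ y → c ~ x → ¬ c ~ y) →
    ∀ {s t u w} → s ~ t → w ⊥ u → ∀ L → ∃[ x ] x ~ u × All (λ z → u ~ z → x ~ z) L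
  dominate-neighbours no-⊥-cone {u = u} s~t w⊥u L =
    case star-coned no-⊥-cone s~t w⊥u (Allₚ.all-filter (u ~?_) L) of λ where
      (x , x~u ∷ x~L) → x , x~u , All.tabulate λ z∈ u~z → All.lookup x~L (∈-filter⁺ (u ~?_) z∈ u~z)

-- The complement.

complement : Graph v e → Graph v (v ⊔ e)
complement G = record
  { Vertex     = Vertex
  ; _~_        = λ x y → x ≢ y × ¬ x ~ y
  ; undirected = λ (x≢y , x≁y) → ≢-sym x≢y , x≁y ∘ undirected
  ; loopless   = λ x≡y (x≢y , _) → x≢y x≡y
  }
  where open Graph G

-- A monomorphism of the complement, inverted, is a monomorphism of G, and the
-- inverse of a bimorphism of G is a bimorphism of the complement.
complement-MB : ∀ {v e} → ExcludedMiddle (v ⊔ e) → (G : Graph v e) →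
  MB-Homogeneous G → MB-Homogeneous (complement G)
complement-MB {v} em G mb A B h (h-hom , h-inj) =
  case mb (mk↣ {to = to B ∘ h} (h-inj ∘ injective B)) A (λ i → i) (back-edge , λ eq → eq) of λ where
    (g , bi , restr) → inverse bi , inverse-bimorphism bi ,
      λ i → proj₁ (proj₂ bi) (trans (inverseˡ bi _) (sym (restr i)))
  where
  open Graph G
  open Injection using (to; injective)

  back-edge : ∀ {i j} → to B (h i) ~ to B (h j) → to A i ~ to A j
  back-edge {i} {j} Bi~Bj = decidable-stable (map′ lower lift (em {Lift v (to A i ~ to A j)}))
    λ Ai≁Aj → proj₂ (h-hom ((λ eq → loopless (cong (to B ∘ h) (injective A eq)) Bi~Bj) , Ai≁Aj)) Bi~Bj

  module _ {g : Vertex → Vertex} (bi : IsBimorphism G g) where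

    inverse : Vertex → Vertex
    inverse y = proj₁ (proj₂ (proj₂ bi) y)

    inverseˡ : ∀ y → g (inverse y) ≡ y
    inverseˡ y = proj₂ (proj₂ (proj₂ bi) y) refl

    inverse-injective : ∀ {x y} → inverse x ≡ inverse y → x ≡ y
    inverse-injective {x} {y} eq = trans (sym (inverseˡ x)) (trans (cong g eq) (inverseˡ y))

    inverse-bimorphism : IsBimorphism (complement G) inverse
    inverse-bimorphism =
      (λ {x} {y} (x≢y , x≁y) → x≢y ∘ inverse-injective , λ adj → x≁y
        (subst (_~ y) (inverseˡ x) (subst (g (inverse x) ~_) (inverseˡ y) (proj₁ bi adj)))) ,
      inverse-injective ,
      (λ y → g y , λ { refl → proj₁ (proj₂ bi) (inverseˡ (g y)) })

-- Back and forth along an enumeration.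

module BackAndForth (G : Graph v e) (enum : ℕ → Graph.Vertex G) (rank : Graph.Vertex G → ℕ)
  (enum-rank : ∀ x → enum (rank x) ≡ x) where

  open Graph G
  open Basics G

  module _
    (forth : ∀ {ps} → PartialHom ps → ∀ x → ∃[ y ] PartialHom ((x , y) ∷ ps))
    (back : ∀ {ps} → PartialHom ps → ∀ y → ∃[ x ] PartialHom ((x , y) ∷ ps))
    {ps₀ : List (Vertex × Vertex)} (hom₀ : PartialHom ps₀)
    where

    private
      State = Σ[ ps ∈ List (Vertex × Vertex) ] PartialHom ps

      step : State → Vertex → State
      step (ps , hom) x with y , hom₁ ← forth hom x with x′ , hom₂ ← back hom₁ x =
        (x′ , x) ∷ (x , y) ∷ ps , hom₂

      chain : ℕ → State
      chain zero    = ps₀ , hom₀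
      chain (suc n) = step (chain n) (enum n)

      infix 4 _∈ₙ_
      _∈ₙ_ : Vertex × Vertex → ℕ → Set _
      p ∈ₙ n = p ∈ proj₁ (chain n)

      chain-mono : ∀ {p m n} → m ≤′ n → p ∈ₙ m → p ∈ₙ n
      chain-mono ≤′-refl       p∈ = p∈
      chain-mono (≤′-step m≤n) p∈ = there (there (chain-mono m≤n p∈))

      compatible : ∀ m n {p q} → p ∈ₙ m → q ∈ₙ n → Compatible p q
      compatible m n p∈ q∈ = proj₂ (chain (m ℕ.⊔ n))
        (chain-mono (≤⇒≤′ (m≤m⊔n m n)) p∈) (chain-mono (≤⇒≤′ (m≤n⊔m m n)) q∈)

      image : ∀ x → ∃[ y ] (x , y) ∈ₙ suc (rank x)
      image x = y , subst (λ z → (z , y) ∈ₙ suc (rank x)) (enum-rank x) (there (here refl))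
        where y = proj₁ (forth (proj₂ (chain (rank x))) (enum (rank x)))

      preimage : ∀ y → ∃[ x ] (x , y) ∈ₙ suc (rank y)
      preimage y = x , subst (λ z → (x , z) ∈ₙ suc (rank y)) (enum-rank y) (here refl)
        where x = proj₁ (back (proj₂ (forth (proj₂ (chain (rank y))) (enum (rank y)))) (enum (rank y)))

      f : Vertex → Vertex
      f x = proj₁ (image x)

      -- The equality clause identifies `f` with the union of the chain, giving surjectivity and
      -- agreement with `ps₀`; the edge clause makes `f` a homomorphism.
      f-compatible : ∀ {x} n {q} → q ∈ₙ n → Compatible (x , f x) q
      f-compatible {x} n = compatible (suc (rank x)) n (proj₂ (image x))

    extendToSurjection : ∃[ g ] IsSurjectiveEndomorphism G g ×
      (∀ {x y} → (x , y) ∈ ps₀ → g x ≡ y)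
    extendToSurjection = f ,
      ((λ {x} {y} → proj₂ (f-compatible {x} (suc (rank y)) (proj₂ (image y)))) ,
       (λ y → proj₁ (preimage y) ,
          λ { refl → proj₁ (f-compatible (suc (rank y)) (proj₂ (preimage y))) refl })) ,
      λ xy∈ → proj₁ (f-compatible 0 xy∈) refl

-- The back step.

module InfiniteHomogeneous (em : ExcludedMiddle (v ⊔ e)) (G : Graph v e) (mb : MB-Homogeneous G)
  (infinite : (L : List (Graph.Vertex G)) → ∃[ x ] x ∉ L) where

  open Graph G
  open Homogeneous em G mb
  private module H = Homogeneous em (complement G) (complement-MB em G mb)

  -- `_⊥_` is definitionally adjacency in the complement, while `H._⊥_` is adjacency in `G`, one
  -- direction by excluded middle.
  ~⇒H⊥ : ∀ {x y} → x ~ y → x H.⊥ y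
  ~⇒H⊥ x~y = ~⇒≢ x~y , λ x~ᴴy → proj₂ x~ᴴy x~y

  H⊥⇒~ : ∀ {x y} → x H.⊥ y → x ~ y
  H⊥⇒~ {x} {y} (x≢y , ¬x⊥y) = decidable-stable (x ~? y) λ x≁y → ¬x⊥y (x≢y , x≁y)

  -- If `R u` holds only inside some finite `L′`, enlarge `L` by `L′` and discard `u`; an empty `U`
  -- contradicts infinity.
  pigeonhole : (R : Vertex → Vertex → Set (v ⊔ e)) → ∀ U L →
    (∀ x → x ∉ L → Any (λ u → R u x) U) → ∃[ u ] Unbounded (R u)
  pigeonhole R []      L cover with x , x∉ ← infinite L with () ← cover x x∉
  pigeonhole R (u ∷ U) L cover with em {Unbounded (R u)}
  ... | yes unb = u , unb
  ... | no ¬unb = case ¬∀ of λ where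
      (L′ , bound) → pigeonhole R U (L′ ++ L) λ x x∉ →
        case cover x (x∉ ∘ Anyₚ.++⁺ʳ L′) of λ where
          (here r)  → contradiction (x , x∉ ∘ Anyₚ.++⁺ˡ , r) bound
          (there r) → r
    where
    ¬∀ : ∃[ L′ ] ¬ (∃[ x ] x ∉ L′ × R u x)
    ¬∀ = decidable-stable em λ ¬∃ → ¬unb λ L′ → decidable-stable em λ none → ¬∃ (L′ , none)

  -- A set without a common neighbour in the complement dominates G.
  unboundedDegree : ∀ {U} → ¬ H.Coned U → ∃[ u ] Unbounded (λ x → Lift v (u ~ x))
  unboundedDegree {U} ¬coned = case pigeonhole (λ u x → u ≡ x ⊎ u ~ x) U [] (λ x _ → cover x) of λ where
      (u , unb) → u , λ L → case unb (u ∷ L) of λ where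
        (x , x∉ , inj₁ refl) → contradiction (here refl) x∉
        (x , x∉ , inj₂ u~x)  → x , x∉ ∘ there , lift u~x
    where
    cover : ∀ x → Any (λ u → u ≡ x ⊎ u ~ x) U
    cover x = Any.map (λ {u} ¬x⊥u → split u ¬x⊥u)
        (¬All⇒Any¬ (λ u → em) U λ x⊥U → ¬coned (x , x⊥U))
      where
      split : ∀ u → ¬ (x ⊥ u) → u ≡ x ⊎ u ~ x
      split u ¬x⊥u with u ≟ x
      ... | yes u≡x = inj₁ u≡x
      ... | no  u≢x = inj₂ (decidable-stable (u ~? x) λ u≁x → ¬x⊥u (⊥-sym (u≢x , u≁x)))

  Back : Set _
  Back = ∀ {ps} → PartialHom ps → ∀ y → ∃[ x ] PartialHom ((x , y) ∷ ps)

  -- A vertex already hit keeps its preimage. For a new `y`, an `x` outside the domain makes the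
  -- equality clause vacuous.
  backFromUnused : (∀ {ps} → PartialHom ps → ∀ y → (∀ {p} → p ∈ ps → y ≢ proj₂ p) →
    ∃[ x ] All (λ p → x ≢ proj₁ p × (x ~ proj₁ p → y ~ proj₂ p)) ps) → Back
  backFromUnused unused {ps} hom y with any? (λ p → y ≟ proj₂ p) ps
  ... | yes y∈ with find y∈
  ...   | (x , _) , p∈ , refl = x , extend hom (All.tabulate (hom p∈))
  backFromUnused unused {ps} hom y | no y∉
    with x , h ← unused hom y (λ p∈ eq → y∉ (Any.map (λ { refl → eq }) p∈)) =
    x , extend hom (All.map (λ (x≢ , adj) → (λ eq → contradiction eq x≢) , adj) h)

  module _ (¬coned : ¬ (∀ U → H.Coned U)) where

    clique-coned : ∀ {K} → AllPairs _~_ K → Coned K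
    clique-coned = clique⇒coned (proj₂ (unboundedDegree (proj₂ witness)))
      where
      witness : ∃[ U ] ¬ H.Coned U
      witness = decidable-stable em λ none →
        ¬coned λ U → decidable-stable em λ ¬U → none (U , ¬U)

    -- Independent lists of the complement are cliques of `G`, so a cone of `J ++ W` in `G` can be
    -- added to `W`.
    fresh : ∀ k {J} → H.Independent J → ∃[ W ] length W ≡ k × H.Independent W ×
      All (λ j → All (j H.⊥_) W) J
    fresh zero    {J} J! = [] , refl , [] , All.tabulate λ _ → []
    fresh (suc k) {J} J! =
      case fresh k J! of λ where
        (W , W-len , W! , J⊥W) →
          case clique-coned (AllPairs.map H⊥⇒~ (AllPairsₚ.++⁺ J! W! J⊥W)) of λ where
            (x , x~) → let x⊥ = All.map ~⇒H⊥ x~ in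
              x ∷ W , cong suc W-len , Allₚ.++⁻ʳ J x⊥ ∷ W! ,
              All.zipWith (λ (x⊥j , j⊥W) → H.⊥-sym x⊥j ∷ j⊥W) (Allₚ.++⁻ˡ J x⊥ , J⊥W)

    -- One such pair coned in the complement would make all pairs, hence all finite sets, coned
    -- there.
    no-⊥-cone : ∀ {x y c} → x H.⊥ y → c ⊥ x → ¬ c ⊥ y
    no-⊥-cone x⊥y c~x c~y =
      ¬coned (H.coned-pairs⇒coned fresh (H.coned-⊥⇒coned-pairs x⊥y c~x c~y))

    hasNeighbour : ∀ u → ∃[ w ] w ~ u
    hasNeighbour u = case clique-coned {u ∷ []} ([] ∷ []) of λ where
      (w , w~u ∷ []) → w , w~u

    -- In the complement `y` and `u′` share a clique, so `x` is sought in the clique of `u`.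
    preimage-⊥ : ∀ {ps} → PartialHom ps → ∀ {y u u′} → (u , u′) ∈ ps →
      (∀ {p} → p ∈ ps → y ≢ proj₂ p) → ¬ y ~ u′ →
      ∃[ x ] All (λ p → x ≢ proj₁ p × (x ~ proj₁ p → y ~ proj₂ p)) ps
    preimage-⊥ {ps} hom {y} {u} u∈ y∉ y≁u′ =
      case H.dominate-neighbours no-⊥-cone (y∉ u∈ , y≁u′)
             (~⇒H⊥ (proj₂ (hasNeighbour u))) (map proj₁ ps) of λ where
        (x , x⊥u , dom) → x , All.tabulate λ p∈ →
          (λ { refl → H.irreflexive (All.lookup dom (∈-map⁺ proj₁ p∈) (⊥-sym x⊥u)) }) ,
          adj x⊥u (Allₚ.map⁻ dom) p∈
      where
      adj : ∀ {x} → x ⊥ u → All (λ p → u ⊥ proj₁ p → x ⊥ proj₁ p) ps →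
        ∀ {p} → p ∈ ps → x ~ proj₁ p → y ~ proj₂ p
      -- Domination gives `u ~ proj₁ p`, hence `u′ ~ proj₂ p`; being complement-adjacent to `u′`,
      -- `y` cannot be so to `proj₂ p` as well.
      adj x⊥u dom {p} p∈ x~p = decidable-stable (y ~? proj₂ p) λ y≁p →
        no-⊥-cone (~⇒H⊥ (proj₂ (hom u∈ p∈) u~p)) (y∉ u∈ , y≁u′) (y∉ p∈ , y≁p)
        where
        u~p : u ~ proj₁ p
        u~p = decidable-stable (u ~? proj₁ p) λ u≁p →
          proj₂ (All.lookup dom p∈ ((λ { refl → proj₂ x⊥u x~p }) , u≁p)) x~p

    unusedPreimage : ∀ {ps} → PartialHom ps → ∀ y → (∀ {p} → p ∈ ps → y ≢ proj₂ p) →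
      ∃[ x ] All (λ p → x ≢ proj₁ p × (x ~ proj₁ p → y ~ proj₂ p)) ps
    unusedPreimage {ps} hom y y∉ = case any? (λ p → ¬? (y ~? proj₂ p)) ps of λ where
      (yes y≁) → case find y≁ of λ where
        (_ , u∈ , y≁u′) → preimage-⊥ hom u∈ y∉ y≁u′
      -- Every image is adjacent to `y`, so any vertex outside the domain will do.
      (no y~)  → case infinite (map proj₁ ps) of λ where
        (x , x∉) → x , All.tabulate λ {p} p∈ → (λ { refl → x∉ (∈-map⁺ proj₁ p∈) }) ,
          λ _ → decidable-stable (y ~? proj₂ p) (λ y≁p → y~ (Any.map (λ { refl → y≁p }) p∈))

  back : Back
  back with em {∀ U → H.Coned U}
  -- A cone in the complement has no edges to the domain, so no edge has to be preserved.
  ... | yes coned = backFromUnused λ {ps} _ y _ → case coned (map proj₁ ps) of λ where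
    (x , x⊥) → x , All.map (λ (x≢ , x≁) → x≢ , λ x~ → contradiction x~ x≁) (Allₚ.map⁻ x⊥)
  ... | no ¬coned = backFromUnused (unusedPreimage ¬coned)

theorem6p1 : ∀ {v e} → ExcludedMiddle (v ⊔ e) →
    (G : Graph v e) → CountablyInfinite G →
    MB-Homogeneous G → HE-Homogeneous G
theorem6p1 em G bij mb {m} A B h h-hom =
  case extendToSurjection forth back hom₀ of λ where
    (g , g-surj , restr) → g , g-surj , λ i → restr (∈-map⁺ pair (∈-allFin i))
  where
  open Graph G
  open Injection using (to; injective)
  rank : Vertex → ℕ
  rank = Bijection.to bij
  enum : ℕ → Vertex
  enum = Bijection.to⁻ bij
  rank-enum : ∀ n → rank (enum n) ≡ n
  rank-enum n = proj₂ (Bijection.strictlySurjective bij n)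
  bounded : ∀ L → ∃[ n ] All (λ x → rank x < n) L
  bounded []      = 0 , []
  bounded (x ∷ L) with n , L<n ← bounded L =
    suc (rank x) ℕ.⊔ n , <-≤-trans (n<1+n _) (m≤m⊔n _ n) ∷
      All.map (λ x<n → <-≤-trans x<n (m≤n⊔m (suc (rank x)) n)) L<n
  infinite : (L : List Vertex) → ∃[ x ] x ∉ L
  infinite L with n , L<n ← bounded L =
    -- `n` exceeds every rank in `L`, so the vertex of rank `n` is missing from it.
    enum n , λ x∈ → <-irrefl (rank-enum n) (All.lookup L<n x∈)
  open InfiniteHomogeneous em G mb infinite using (back)
  open Homogeneous em G mb using (PartialHom; forth)
  open BackAndForth G enum rank (λ x → Bijection.injective bij (rank-enum (rank x)))
  pair : Fin m → Vertex × Vertex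
  pair i = to A i , to B (h i)
  hom₀ : PartialHom (map pair (allFin m))
  hom₀ p∈ q∈ with ∈-map⁻ pair p∈ | ∈-map⁻ pair q∈
  ... | i , _ , refl | j , _ , refl = cong (to B ∘ h) ∘ injective A , h-hom
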